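{- $\mathsf{STC}\not\le\mathsf{LREC}$.
   Context: For logics $\mathsf L,\mathsf L'$, $\mathsf L\le\mathsf L'$ means that $\mathsf L$ is semantically contained in $\mathsf L'$: for every vocabulary $\tau$, every $\mathsf L[\tau]$-formula is equivalent (over all finite $\tau$-structures and all assignments) to an $\mathsf L'[\tau]$-formula. Symmetric transitive closure logic $\mathsf{STC}$ is the extension of first-order logic by the operator $[\mathrm{stc}_{\bar u,\bar v}\,\psi](\bar s,\bar t)$ ($\bar u,\bar v,\bar s,\bar t$ tuples of structure variables of the same length), which holds in $(A,\alpha)$ iff $(\alpha(\bar s),\alpha(\bar t))$ belongs to the reflexive, symmetric, transitive closure of the relation $\psi[A,\alpha;\bar u,\bar v]$. Basic conventions. $[m,n]=\{p\in\mathbb{N}: m\le p\le n\}$. A vocabulary $\tau$ is a finite set of relation symbols $R$ with arities $\mathrm{ar}(R)$. A $\tau$-structure $A$ has a non-empty finite universe $V(A)$ and relations $R(A)\subseteq V(A)^{\mathrm{ar}(R)}$. Every structure $A$ is equipped with a number sort $N(A)=[0,|V(A)|]$. Variables are either structure variables (ranging over $V(A)$) or number variables (ranging over $N(A)$); $A^u$ is $V(A)$ or $N(A)$ accordingly, and $A^{(u_1,\dots,u_k)}=A^{u_1}\times\dots\times A^{u_k}$. Two tuples of variables are compatible if they have the same length and the same types position by position. For a tuple $\bar u$, $\tilde u$ is the set of its entries. An assignment $\alpha$ in $A$ maps each variable $u$ to an element of $A^u$; $\alpha[\bar a/\bar u]$ is $\alpha$ modified to map $\bar u$ to $\bar a$.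 For $\bar n=(n_1,\dots,n_k)\in N(A)^k$ let $\langle\bar n\rangle=\langle\bar n\rangle_A=\sum_{i=1}^k n_i(|V(A)|+1)^{i-1}$. The logic $\mathsf{FO{+}C}[\tau]$ extends (two-sorted) first-order logic over $\tau$ by formulae $p\le q$ for number variables $p,q$, and $\#\bar u\,\psi=\bar p$ for a tuple $\bar u$ of variables, a tuple $\bar p$ of number variables and a formula $\psi$; the latter holds in $(A,\alpha)$ iff $|\{\bar a\in A^{\bar u}:(A,\alpha[\bar a/\bar u])\models\psi\}|=\langle\alpha(\bar p)\rangle_A$. Write $\varphi[A,\alpha;\bar u]=\{\bar a\in A^{\bar u}:(A,\alpha[\bar a/\bar u])\models\varphi\}$. The logic $\mathsf{LREC}$. $\mathsf{LREC}[\tau]$ is obtained by adding to the formation rules of $\mathsf{FO{+}C}[\tau]$ the rule: if $\bar u,\bar v,\bar w$ are compatible tuples of variables, $\bar p,\bar r$ are non-empty tuples of number variables, and $\varphi_E,\varphi_C$ are $\mathsf{LREC}[\tau]$-formulae, then $\varphi=[\mathrm{lrec}_{\bar u,\bar v,\bar p}\;\varphi_E,\varphi_C](\bar w,\bar r)$ is an $\mathsf{LREC}[\tau]$-formula, with free variables $(\mathrm{free}(\varphi_E)\setminus(\tilde u\cup\tilde v))\cup(\mathrm{free}(\varphi_C)\setminus(\tilde u\cup\tilde p))\cup\tilde w\cup\tilde r$. Semantics: given $(A,\alpha)$, let $\mathtt V=A^{\bar u}$, $\mathtt E=\varphi_E[A,\alpha;\bar u,\bar v]\subseteq\mathtt V^2$,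 and for $\bar a\in\mathtt V$ let $\mathtt C(\bar a)=\{\langle\bar n\rangle:\bar n\in\varphi_C[A,\alpha[\bar a/\bar u];\bar p]\}$, $\bar a\mathtt E=\{\bar b:\bar a\bar b\in\mathtt E\}$, $\mathtt E\bar b=\{\bar a:\bar a\bar b\in\mathtt E\}$. The relation $X\subseteq\mathtt V\times\mathbb N$ defined by $\varphi$ in $(A,\alpha)$ is given recursively by: $(\bar a,\ell)\in X$ iff $\ell>0$ and $\bigl|\{\bar b\in\bar a\mathtt E:(\bar b,\lfloor(\ell-1)/|\mathtt E\bar b|\rfloor)\in X\}\bigr|\in\mathtt C(\bar a)$. Then $(A,\alpha)\models\varphi$ iff $(\alpha(\bar w),\langle\alpha(\bar r)\rangle)\in X$. -}

module Defs where

open import Data.Bool.Base using (Bool; true; false; T; not; _∧_; _∨_; if_then_else_)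
open import Data.Bool.ListAction using (any; all)
open import Data.Fin.Base using (Fin; toℕ)
open import Data.List.Base
  using (List; []; _∷_; length; filterᵇ; cartesianProductWith; allFin; replicate)
open import Data.List.Relation.Unary.All using (All; []; _∷_)
open import Data.Nat.Base using (ℕ; zero; suc; _+_; _*_; _/_; _≤_; _<_; z≤n; s≤s; _≡ᵇ_; _≤ᵇ_)
open import Data.Nat.DivMod using (m/n≤m)
open import Data.Nat.Induction using (<-wellFounded)
open import Data.Product.Base using (∃-syntax; _×_)
open import Data.Sum.Base using (_⊎_)
open import Data.Vec.Base as Vec using (Vec)
open import Function.Bundles using (_⇔_)
open import Induction.WellFounded using (Acc; acc)
open import Relation.Binary.Construct.Closure.Equivalence using (EqClosure)
open import Relation.Binary.PropositionalEquality using (_≡_; refl; cong)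
open import Relation.Nullary using (¬_)

------------------------------------------------------------------------
-- Vocabularies and structures

record Vocabulary : Set where
  field
    size : ℕ
    ar   : Fin size → ℕ

open Vocabulary public

-- Up to isomorphism a non-empty finite universe is {0, …, n} = Fin (suc n).
-- Relations are finite sets of tuples, given by their characteristic
-- functions.

record Structure (τ : Vocabulary) : Set where
  field
    ∣V∣-1 : ℕ

  ∣V∣ : ℕ
  ∣V∣ = suc ∣V∣-1

  field
    rel : (R : Fin (size τ)) → Vec (Fin ∣V∣) (ar τ R) → Bool

open Structure public

------------------------------------------------------------------------
-- Variables, tuples and assignments

data Sort : Set where
  str num : Sort

data Var : Sort → Set where
  sv : ℕ → Var str
  nv : ℕ → Var num

-- Tuples of variables are indexed by the list of their types, so two tuples
-- are compatible exactly when they have the same index.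

Vars : List Sort → Set
Vars = All Var

strs nums : ℕ → List Sort
strs k = replicate k str
nums k = replicate k num

private
  variable
    τ : Vocabulary

-- V(A) has ∣V∣ elements and N(A) = [0, ∣V∣] has ∣V∣ + 1.

card : Structure τ → Sort → ℕ
card A str = ∣V∣ A
card A num = suc (∣V∣ A)

Dom : Structure τ → Sort → Set
Dom A s = Fin (card A s)

Tuple : Structure τ → List Sort → Set
Tuple A = All (Dom A)

tuples : (A : Structure τ) (σ : List Sort) → List (Tuple A σ)
tuples A []      = [] ∷ []
tuples A (s ∷ σ) = cartesianProductWith _∷_ (allFin (card A s)) (tuples A σ)

Assignment : Structure τ → Set
Assignment A = ∀ {s} → Var s → Dom A s

module _ {A : Structure τ} where

  _[_≔_] : Assignment A → ∀ {s} → Var s → Dom A s → Assignment A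
  (α [ sv i ≔ a ]) (sv j) = if i ≡ᵇ j then a else α (sv j)
  (α [ sv i ≔ a ]) (nv j) = α (nv j)
  (α [ nv i ≔ a ]) (sv j) = α (sv j)
  (α [ nv i ≔ a ]) (nv j) = if i ≡ᵇ j then a else α (nv j)

  -- If a variable occurs repeatedly in the tuple, its last occurrence counts.

  _[_≔*_] : Assignment A → ∀ {σ} → Vars σ → Tuple A σ → Assignment A
  α [ []     ≔* []     ] = α
  α [ u ∷ us ≔* a ∷ as ] = (α [ u ≔ a ]) [ us ≔* as ]

  values : Assignment A → ∀ {σ} → Vars σ → Tuple A σ
  values α []       = []
  values α (u ∷ us) = α u ∷ values α us

-- number A k n is ⟨n⟩: base ∣V∣ + 1, least significant digit first.

number : (A : Structure τ) (k : ℕ) → Tuple A (nums k) → ℕ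
number A zero    []       = 0
number A (suc k) (n ∷ ns) = toℕ n + suc (∣V∣ A) * number A k ns

------------------------------------------------------------------------
-- Logics

record Logic : Set₁ where
  field
    Formula : Vocabulary → Set
    Sat     : (A : Structure τ) → Assignment A → Formula τ → Set

infix 4 _≼_

_≼_ : Logic → Logic → Set
L ≼ L′ = ∀ (τ : Vocabulary) (φ : Formula L τ) →
         ∃[ ψ ] (∀ (A : Structure τ) (α : Assignment A) →
                 Sat L A α φ ⇔ Sat L′ A α ψ)
  where open Logic

------------------------------------------------------------------------
-- Symmetric transitive closure logic

module STC-Logic where

  data Formula (τ : Vocabulary) : Set where
    atom  : (R : Fin (size τ)) → Vec (Var str) (ar τ R) → Formula τ
    _≐_   : Var str → Var str → Formula τ
    ¬ᶠ_   : Formula τ → Formula τ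
    _∧ᶠ_  : Formula τ → Formula τ → Formula τ
    _∨ᶠ_  : Formula τ → Formula τ → Formula τ
    ∃ᶠ_∙_ : Var str → Formula τ → Formula τ
    ∀ᶠ_∙_ : Var str → Formula τ → Formula τ
    -- stc u v ψ s t  is  [stc_{u,v} ψ](s, t)
    stc   : ∀ {k} (u v : Vars (strs k)) → Formula τ →
            (s t : Vars (strs k)) → Formula τ

  Sat : (A : Structure τ) → Assignment A → Formula τ → Set
  Sat A α (atom R us)     = T (rel A R (Vec.map α us))
  Sat A α (u ≐ v)         = α u ≡ α v
  Sat A α (¬ᶠ φ)          = ¬ Sat A α φ
  Sat A α (φ ∧ᶠ ψ)        = Sat A α φ × Sat A α ψ
  Sat A α (φ ∨ᶠ ψ)        = Sat A α φ ⊎ Sat A α ψ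
  Sat A α (∃ᶠ u ∙ φ)      = ∃[ a ] Sat A (α [ u ≔ a ]) φ
  Sat A α (∀ᶠ u ∙ φ)      = ∀ a → Sat A (α [ u ≔ a ]) φ
  Sat A α (stc u v ψ s t) =
    EqClosure (λ a b → Sat A ((α [ u ≔* a ]) [ v ≔* b ]) ψ)
              (values α s) (values α t)

STC : Logic
STC = record { Formula = STC-Logic.Formula ; Sat = STC-Logic.Sat }

------------------------------------------------------------------------
-- The relation X of the lrec operator

-- Division with a junk value at divisor 0.

_/₀_ : ℕ → ℕ → ℕ
m /₀ zero  = 0
m /₀ suc d = m / suc d

/₀-≤ : ∀ m d → (m /₀ d) ≤ m
/₀-≤ m zero    = z≤n
/₀-≤ m (suc d) = m/n≤m m (suc d)

count : {V : Set} → List V → (V → Bool) → ℕ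
count vs P = length (filterᵇ P vs)

-- vs enumerates 𝚅 without repetition. The junk value of /₀ is never used:
-- E a b implies that b has positive in-degree.

module Recursion {V : Set} (vs : List V) (E : V → V → Bool) (C : V → ℕ → Bool) where

  indegree : V → ℕ
  indegree b = count vs (λ a → E a b)

  X-acc : (a : V) (ℓ : ℕ) → Acc _<_ ℓ → Bool
  X-acc a zero    _        = false
  X-acc a (suc ℓ) (acc rs) =
    C a (count vs (λ b → E a b ∧ X-acc b (ℓ /₀ indegree b) (rs (s≤s (/₀-≤ ℓ (indegree b))))))

  X : V → ℕ → Bool
  X a ℓ = X-acc a ℓ (<-wellFounded ℓ)

  -- X satisfies its defining recursion, independently of accessibility proofs.

  private
    count-cong : ∀ ws {P Q : V → Bool} → (∀ v → P v ≡ Q v) → count ws P ≡ count ws Q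
    count-cong []       eq = refl
    count-cong (w ∷ ws) {P} {Q} eq with P w | Q w | eq w
    ... | true  | _ | refl = cong suc (count-cong ws eq)
    ... | false | _ | refl = count-cong ws eq

  X-acc-irrelevant : ∀ a ℓ (r r′ : Acc _<_ ℓ) → X-acc a ℓ r ≡ X-acc a ℓ r′
  X-acc-irrelevant a zero    _        _         = refl
  X-acc-irrelevant a (suc ℓ) (acc rs) (acc rs′) =
    cong (C a) (count-cong vs λ b → cong (E a b ∧_) (X-acc-irrelevant b (ℓ /₀ indegree b) _ _))

  X-zero : ∀ a → X a 0 ≡ false
  X-zero a = refl

  X-suc : ∀ a ℓ → X a (suc ℓ) ≡ C a (count vs (λ b → E a b ∧ X b (ℓ /₀ indegree b)))
  X-suc a ℓ =
    cong (C a) (count-cong vs λ b → cong (E a b ∧_) (X-acc-irrelevant b (ℓ /₀ indegree b) _ _))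

------------------------------------------------------------------------
-- The logic LREC

module LREC-Logic where

  data Formula (τ : Vocabulary) : Set where
    atom  : (R : Fin (size τ)) → Vec (Var str) (ar τ R) → Formula τ
    _≐_   : ∀ {s} → Var s → Var s → Formula τ
    _≤ᶠ_  : Var num → Var num → Formula τ
    ¬ᶠ_   : Formula τ → Formula τ
    _∧ᶠ_  : Formula τ → Formula τ → Formula τ
    _∨ᶠ_  : Formula τ → Formula τ → Formula τ
    ∃ᶠ_∙_ : ∀ {s} → Var s → Formula τ → Formula τ
    ∀ᶠ_∙_ : ∀ {s} → Var s → Formula τ → Formula τ
    -- # u ψ q  is  #u ψ = q
    #     : ∀ {σ k} → Vars σ → Formula τ → Vars (nums k) → Formula τ
    -- lrec u v q φE φC w r  is  [lrec_{u,v,q} φE, φC](w, r)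
    lrec  : ∀ {σ k l} (u v : Vars σ) (q : Vars (nums (suc k))) →
            (φE φC : Formula τ) → (w : Vars σ) (r : Vars (nums (suc l))) → Formula τ

  -- All structures are finite, so satisfaction is computed as a truth value.

  eval : (A : Structure τ) → Assignment A → Formula τ → Bool
  eval A α (atom R us) = rel A R (Vec.map α us)
  eval A α (u ≐ v)     = toℕ (α u) ≡ᵇ toℕ (α v)
  eval A α (u ≤ᶠ v)    = toℕ (α u) ≤ᵇ toℕ (α v)
  eval A α (¬ᶠ φ)      = not (eval A α φ)
  eval A α (φ ∧ᶠ ψ)    = eval A α φ ∧ eval A α ψ
  eval A α (φ ∨ᶠ ψ)    = eval A α φ ∨ eval A α ψ
  eval A α (∃ᶠ_∙_ {s} u φ) = any (λ a → eval A (α [ u ≔ a ]) φ) (allFin (card A s))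
  eval A α (∀ᶠ_∙_ {s} u φ) = all (λ a → eval A (α [ u ≔ a ]) φ) (allFin (card A s))
  eval A α (# {σ} {k} u ψ q) =
    count (tuples A σ) (λ a → eval A (α [ u ≔* a ]) ψ) ≡ᵇ number A k (values α q)
  eval A α (lrec {σ} {k} {l} u v q φE φC w r) =
    Recursion.X (tuples A σ) E C (values α w) (number A (suc l) (values α r))
    where
    E : Tuple A σ → Tuple A σ → Bool
    E a b = eval A ((α [ u ≔* a ]) [ v ≔* b ]) φE

    C : Tuple A σ → ℕ → Bool
    C a m = any (λ n → (number A (suc k) n ≡ᵇ m) ∧ eval A ((α [ u ≔* a ]) [ q ≔* n ]) φC)
                (tuples A (nums (suc k)))

  Sat : (A : Structure τ) → Assignment A → Formula τ → Set
  Sat A α φ = T (eval A α φ)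

LREC : Logic
LREC = record { Formula = LREC-Logic.Formula ; Sat = LREC-Logic.Sat }

{-# OPTIONS --safe #-}

-- Consider two disjoint paths of length m with every vertex replaced by n + 1
-- twins, so that adjacent levels of a strand are completely joined. The two
-- strands are exchanged above a cut by `twist`, which is a local isomorphism
-- away from the cut. Whether the ends of a path are connected depends on the
-- parity of cuts between them. For an LREC formula a cut that is far from all
-- assigned vertices is undetectable: when a quantified vertex comes close to the
-- cut, the cut is moved away, by an amount that depends only on the level of
-- the vertex, so that the answers form a bijection.
--
-- For lrec, consider an edge (a, b) of the defined graph. If a has an entry
-- that is neither an entry of b nor a parameter, then permuting twins shows that
-- b has in-degree close to n, and the resource ℓ, which is polynomial in n,
-- is divided by it; this happens boundedly often. All other steps keep the
-- entries of a, so only boundedly many of them introduce a vertex near which the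
-- cut may have to be moved. Hence a cut at a distance that does not depend on n
-- survives the entire recursion.
module Submission where

open import Defs
open import Data.Bool.Base using (Bool; true; false; T; not; _∧_; _∨_; if_then_else_)
open import Data.Bool.ListAction using (any; all)
open import Data.Bool.Properties using (T?; T-∧)
open import Data.Empty using (⊥-elim)
open import Data.Fin.Base using (Fin; zero; suc; toℕ; combine; remQuot; opposite; fromℕ<)
open import Data.Fin.Permutation.Components using (transpose; transpose-inverse)
open import Data.Fin.Properties
  using (_≟_; remQuot-combine; combine-remQuot; opposite-involutive; toℕ<n; toℕ≤pred[n]; toℕ-fromℕ<; toℕ-injective)
open import Data.List.Base using (List; []; _∷_; _++_; length; map; filterᵇ; allFin)
import Data.List.Membership.DecPropositional as DecMembership
open import Data.List.Membership.Propositional using (_∈_; _∉_; find; lose)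
open import Data.List.Membership.Propositional.Properties
  using (∈-∃++; ∈-++⁻; ∈-++⁺ˡ; ∈-++⁺ʳ; ∈-filter⁺; ∈-filter⁻; ∈-map⁺; ∈-map⁻; ∈-allFin; ∈-cartesianProductWith⁺)
open import Data.List.Properties using (length-++; length-map; length-tabulate)
open import Data.List.Relation.Binary.Subset.Propositional using (_⊆_)
open import Data.List.Relation.Unary.All as All using (All; []; _∷_)
open import Data.List.Relation.Unary.All.Properties using (¬All⇒Any¬)
open import Data.List.Relation.Unary.AllPairs using ([]; _∷_)
open import Data.List.Relation.Unary.Any using (here; there)
open import Data.List.Relation.Unary.Any.Properties using (any⁺; any⁻)
open import Data.List.Relation.Unary.Unique.Propositional using (Unique)
open import Data.List.Relation.Unary.Unique.Propositional.Properties
  using (map⁺; filter⁺; cartesianProductWith⁺; allFin⁺)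
open import Data.Nat.Base
open import Data.Nat.DivMod using (m<n*o⇒m/o<n)
open import Data.Nat.Induction using (<-wellFounded)
open import Data.Nat.Properties hiding (_≟_)
open import Data.Product.Base using (_×_; _,_; proj₁; proj₂; ∃)
open import Data.Sum.Base using (_⊎_; inj₁; inj₂; [_,_]′)
open import Data.Vec.Base using ([]; _∷_)
open import Function.Base using (_∘_; id)
open import Function.Bundles using (Equivalence)
open import Induction.WellFounded using (Acc; acc)
import Relation.Binary.Construct.Closure.Equivalence as EqClosure
open import Relation.Binary.Construct.Closure.ReflexiveTransitive using (ε; _◅◅_)
open import Relation.Binary.PropositionalEquality
open import Relation.Nullary using (¬_; Dec; yes; no; does; contradiction)
open import Relation.Nullary.Decidable using (_⊎-dec_)
open LREC-Logic

private
  variable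
    V W : Set
    τ : Vocabulary
    A : Structure τ
    s : Sort
    σ : List Sort

-- Counting and searching along bijections.

T-ext : ∀ {b c} → (T b → T c) → (T c → T b) → b ≡ c
T-ext {false} {false} _ _ = refl
T-ext {false} {true}  _ g = ⊥-elim (g _)
T-ext {true}  {false} f _ = ⊥-elim (f _)
T-ext {true}  {true}  _ _ = refl

∧-congᵀ : ∀ {b b′ c c′} → b ≡ b′ → (T b → c ≡ c′) → b ∧ c ≡ b′ ∧ c′
∧-congᵀ {false} refl _ = refl
∧-congᵀ {true}  refl f = f _

length-mono-⊆ : {xs ys : List V} → Unique xs → xs ⊆ ys → length xs ≤ length ys
length-mono-⊆ {xs = []}     _           _   = z≤n
length-mono-⊆ {xs = x ∷ xs} (x∉xs ∷ xs!) sub with ∈-∃++ (sub (here refl))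
... | as , bs , refl = begin
  suc (length xs)               ≤⟨ s≤s (length-mono-⊆ xs! sub′) ⟩
  suc (length (as ++ bs))       ≡⟨ cong suc (length-++ as) ⟩
  suc (length as + length bs)   ≡⟨ +-suc (length as) (length bs) ⟨
  length as + suc (length bs)   ≡⟨ length-++ as ⟨
  length (as ++ x ∷ bs)         ∎
  where
  open ≤-Reasoning
  sub′ : xs ⊆ as ++ bs
  sub′ y∈xs with ∈-++⁻ as (sub (there y∈xs))
  ... | inj₁ y∈as         = ∈-++⁺ˡ y∈as
  ... | inj₂ (here refl)  = contradiction refl (All.lookup x∉xs y∈xs)
  ... | inj₂ (there y∈bs) = ∈-++⁺ʳ as y∈bs

module _ {vs : List V} (complete : ∀ v → v ∈ vs) where

  count-mono-injective : {ws : List W} → Unique ws → {P : W → Bool} {Q : V → Bool} (f : W → V) →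
                         (∀ {x y} → f x ≡ f y → x ≡ y) → (∀ w → T (P w) → T (Q (f w))) →
                         count ws P ≤ count vs Q
  count-mono-injective {ws = ws} ws! {P} {Q} f inj P⇒Q = begin
    length (filterᵇ P ws)          ≡⟨ length-map f (filterᵇ P ws) ⟨
    length (map f (filterᵇ P ws))  ≤⟨ length-mono-⊆ (map⁺ inj (filter⁺ (T? ∘ P) ws!)) sub ⟩
    length (filterᵇ Q vs)          ∎
    where
    open ≤-Reasoning
    sub : map f (filterᵇ P ws) ⊆ filterᵇ Q vs
    sub v∈ with ∈-map⁻ f v∈
    ... | w , w∈ , refl =
      ∈-filter⁺ (T? ∘ Q) (complete (f w)) (P⇒Q w (proj₂ (∈-filter⁻ (T? ∘ P) {xs = ws} w∈)))

  module _ {f g : V → V} (g∘f : ∀ v → g (f v) ≡ v) (f∘g : ∀ v → f (g v) ≡ v)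
           {P Q : V → Bool} (P≗Q∘f : ∀ v → P v ≡ Q (f v)) where

    private
      Q≗P∘g : ∀ v → Q v ≡ P (g v)
      Q≗P∘g v = sym (trans (P≗Q∘f (g v)) (cong Q (f∘g v)))

    count-bijection : Unique vs → count vs P ≡ count vs Q
    count-bijection vs! = ≤-antisym
      (count-mono-injective vs! f
        (λ {x} {y} e → trans (sym (g∘f x)) (trans (cong g e) (g∘f y)))
        (λ v → subst T (P≗Q∘f v)))
      (count-mono-injective vs! g
        (λ {x} {y} e → trans (sym (f∘g x)) (trans (cong f e) (f∘g y)))
        (λ v → subst T (Q≗P∘g v)))

    any-bijection : any P vs ≡ any Q vs
    any-bijection = T-ext (transfer f P≗Q∘f) (transfer g Q≗P∘g)
      where
      transfer : ∀ {P Q : V → Bool} (h : V → V) → (∀ v → P v ≡ Q (h v)) → T (any P vs) → T (any Q vs)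
      transfer {P} {Q} h eq t with find (any⁻ P vs t)
      ... | v , _ , pv = any⁺ Q (lose (complete (h v)) (subst T (eq v) pv))

all≡not-any-not : (P : V → Bool) (vs : List V) → all P vs ≡ not (any (not ∘ P) vs)
all≡not-any-not P []       = refl
all≡not-any-not P (v ∷ vs) with P v
... | true  = all≡not-any-not P vs
... | false = refl

any-cong : {P Q : V → Bool} → (∀ v → P v ≡ Q v) → (vs : List V) → any P vs ≡ any Q vs
any-cong eq []       = refl
any-cong eq (v ∷ vs) = cong₂ _∨_ (eq v) (any-cong eq vs)

-- Cuts, and moving them away from given levels.

-- A cut `q` lies just below level `q`, hence the strict inequality on one side only; radius `0`
-- excludes no level.
Far : ℕ → ℕ → ℕ → Set
Far r q h = h + r < q ⊎ q + r ≤ h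

far? : ∀ r q h → Dec (Far r q h)
far? r q h = (h + r <? q) ⊎-dec (q + r ≤? h)

Far-weaken : ∀ {r r′ q h} → r′ ≤ r → Far r q h → Far r′ q h
Far-weaken {h = h} r′≤r (inj₁ lt) = inj₁ (≤-<-trans (+-monoʳ-≤ h r′≤r) lt)
Far-weaken {q = q} r′≤r (inj₂ le) = inj₂ (≤-trans (+-monoʳ-≤ q r′≤r) le)

abstract

  below : ℕ → ℕ → Bool
  below q h = h <ᵇ q

  below-true : ∀ {q h} → h < q → below q h ≡ true
  below-true h<q = T-ext (λ _ → _) (λ _ → <⇒<ᵇ h<q)

  below-false : ∀ {q h} → q ≤ h → below q h ≡ false
  below-false {q} {h} q≤h = T-ext (λ t → ≤⇒≯ q≤h (<ᵇ⇒< h q t)) λ ()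

-- Whatever is at distance 3r from the old cut q stays on its side of the new cut
-- and at distance r from it; a tuple of k levels therefore costs a factor 3 ^ k.
shift : ℕ → ℕ → ℕ → ℕ
shift r q h with far? r q h
... | yes _ = q
... | no  _ = q + (r + r)

shift-far : ∀ r q h → Far r (shift r q h) h
shift-far r q h with far? r q h
... | yes far = far
-- Here `h < q + r`, so a cut raised by `2r` passes `h` with distance `r` to spare.
... | no ¬far = inj₁ (begin-strict
  h + r        <⟨ +-monoˡ-< r (≰⇒> (¬far ∘ inj₂)) ⟩
  q + r + r    ≡⟨ +-assoc q r r ⟩
  q + (r + r)  ∎)
  where open ≤-Reasoning

shift-fixed : ∀ {r q h} → Far r q h → shift r q h ≡ q
shift-fixed {r} {q} {h} far with far? r q h
... | yes _   = refl
... | no ¬far = contradiction far ¬far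

shift-keeps : ∀ {r q x} h → Far (3 * r) q x → Far r (shift r q h) x × below (shift r q h) x ≡ below q x
shift-keeps {r} {q} {x} h far with far? r q h
... | yes _ = Far-weaken (m≤m+n r _) far , refl
... | no  _ with far
... | inj₁ lt = inj₁ (≤-trans x+r<q (m≤m+n q _)) ,
                trans (below-true (≤-trans x<q (m≤m+n q _))) (sym (below-true x<q))
  where
  x+r<q : x + r < q
  x+r<q = ≤-<-trans (+-monoʳ-≤ x (m≤m+n r _)) lt
  x<q : x < q
  x<q = ≤-<-trans (m≤m+n x _) lt
... | inj₂ le = inj₂ far′ ,
                trans (below-false (≤-trans (m≤m+n _ r) far′)) (sym (below-false (≤-trans (m≤m+n q _) le)))
  where
  open ≤-Reasoning
  far′ : q + (r + r) + r ≤ x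
  far′ = begin
    q + (r + r) + r        ≡⟨ +-assoc q (r + r) r ⟩
    q + (r + r + r)        ≡⟨ cong (q +_) (trans (+-assoc r r r) (cong (λ z → r + (r + z)) (sym (+-identityʳ r)))) ⟩
    q + 3 * r              ≤⟨ le ⟩
    x                      ∎

-- Each later move may shrink the clearance already won by a factor 3. A level followed by `j`
-- others is therefore cleared with radius `3 ^ j * r`, and every level ends with at least `r`.
relocate : ℕ → ℕ → List ℕ → ℕ
relocate r q []       = q
relocate r q (h ∷ hs) = relocate r (shift (3 ^ length hs * r) q h) hs

relocate-keeps : ∀ {r q x} hs → Far (3 ^ length hs * r) q x →
                 Far r (relocate r q hs) x × below (relocate r q hs) x ≡ below q x
relocate-keeps {r} []       far = Far-weaken (m≤m+n r _) far , refl
relocate-keeps {r} {q} {x} (h ∷ hs) far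
  with shift-keeps {3 ^ length hs * r} h (subst (λ z → Far z q x) (*-assoc 3 (3 ^ length hs) r) far)
... | far₁ , side₁ with relocate-keeps hs far₁
... | far₂ , side₂ = far₂ , trans side₂ side₁

relocate-far : ∀ {r q h} hs → h ∈ hs → Far r (relocate r q hs) h
relocate-far {r} {q} (h ∷ hs) (here refl) = proj₁ (relocate-keeps hs (shift-far (3 ^ length hs * r) q h))
relocate-far (h ∷ hs) (there h∈) = relocate-far hs h∈

-- Lets a recursion step that brings in no new vertex keep the cut, and hence lose no radius.
relocate-fixed : ∀ {r q} hs → (∀ {h} → h ∈ hs → Far (3 ^ length hs * r) q h) → relocate r q hs ≡ q
relocate-fixed []       far = refl
relocate-fixed {r} {q} (h ∷ hs) far =
  trans (cong (λ z → relocate r z hs) (shift-fixed (weaken (far (here refl)))))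
        (relocate-fixed hs (weaken ∘ far ∘ there))
  where
  weaken : ∀ {x} → Far (3 ^ suc (length hs) * r) q x → Far (3 ^ length hs * r) q x
  weaken = Far-weaken (*-monoˡ-≤ r (m≤m+n (3 ^ length hs) _))

-- Transpositions, tuples over a structure, and assignments.

module _ {n : ℕ} where

  transpose-i : (i j : Fin n) → transpose i j i ≡ j
  transpose-i i j with i ≟ i
  ... | yes _  = refl
  ... | no i≢i = contradiction refl i≢i

  transpose-fixed : {i j k : Fin n} → k ≢ i → k ≢ j → transpose i j k ≡ k
  transpose-fixed {i} {j} {k} k≢i k≢j with k ≟ i
  ... | yes k≡i = contradiction k≡i k≢i
  ... | no  _ with k ≟ j
  ...   | yes k≡j = contradiction k≡j k≢j
  ...   | no  _   = refl

  transpose-invariant : (f : Fin n → V) {i j : Fin n} → f i ≡ f j → ∀ k → f (transpose i j k) ≡ f k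
  transpose-invariant f {i} {j} eq k with k ≟ i
  ... | yes refl = sym eq
  ... | no  _ with k ≟ j
  ...   | yes refl = eq
  ...   | no  _    = refl

∈-tuples : (A : Structure τ) (t : Tuple A σ) → t ∈ tuples A σ
∈-tuples A []      = here refl
∈-tuples A (a ∷ t) = ∈-cartesianProductWith⁺ _∷_ (∈-allFin a) (∈-tuples A t)

tuples! : (A : Structure τ) (σ : List Sort) → Unique (tuples A σ)
tuples! A []      = [] ∷ []
tuples! A (s ∷ σ) = cartesianProductWith⁺ _∷_ (λ { refl → refl , refl }) (allFin⁺ _) (tuples! A σ)

number-bound : (A : Structure τ) (k : ℕ) (t : Tuple A (nums k)) → number A k t < suc (∣V∣ A) ^ k
number-bound A zero    []      = s≤s z≤n
number-bound A (suc k) (a ∷ t) = begin-strict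
  toℕ a + b * number A k t   <⟨ +-monoˡ-< _ (toℕ<n a) ⟩
  b + b * number A k t       ≡⟨ *-suc b _ ⟨
  b * suc (number A k t)     ≤⟨ *-monoʳ-≤ b (number-bound A k t) ⟩
  b * b ^ k                  ∎
  where
  open ≤-Reasoning
  b : ℕ
  b = suc (∣V∣ A)

module Tuples {τ : Vocabulary} (A : Structure τ) where

  Vertex : Set
  Vertex = Fin (∣V∣ A)

  mapDom : (Vertex → Vertex) → Dom A s → Dom A s
  mapDom {s = str} f = f
  mapDom {s = num} f = id

  mapTuple : (Vertex → Vertex) → Tuple A σ → Tuple A σ
  mapTuple f []      = []
  mapTuple f (a ∷ t) = mapDom f a ∷ mapTuple f t

  entries : Tuple A σ → List Vertex
  entries {σ = []}      []      = []
  entries {σ = str ∷ σ} (a ∷ t) = a ∷ entries t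
  entries {σ = num ∷ σ} (a ∷ t) = entries t

  length-entries : (t : Tuple A σ) → length (entries t) ≤ length σ
  length-entries {σ = []}      []      = z≤n
  length-entries {σ = str ∷ σ} (a ∷ t) = s≤s (length-entries t)
  length-entries {σ = num ∷ σ} (a ∷ t) = m≤n⇒m≤1+n (length-entries t)

  entries-nums : ∀ k (t : Tuple A (nums k)) → entries t ≡ []
  entries-nums zero    []      = refl
  entries-nums (suc k) (a ∷ t) = entries-nums k t

  mapTuple-cong : ∀ {f g} (t : Tuple A σ) → (∀ {v} → v ∈ entries t → f v ≡ g v) →
                  mapTuple f t ≡ mapTuple g t
  mapTuple-cong {σ = []}      []      eq = refl
  mapTuple-cong {σ = str ∷ σ} (a ∷ t) eq = cong₂ _∷_ (eq (here refl)) (mapTuple-cong t (eq ∘ there))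
  mapTuple-cong {σ = num ∷ σ} (a ∷ t) eq = cong (a ∷_) (mapTuple-cong t eq)

  mapTuple-∘ : ∀ f g (t : Tuple A σ) → mapTuple f (mapTuple g t) ≡ mapTuple (f ∘ g) t
  mapTuple-∘ {σ = []}      f g []      = refl
  mapTuple-∘ {σ = str ∷ σ} f g (a ∷ t) = cong (_ ∷_) (mapTuple-∘ f g t)
  mapTuple-∘ {σ = num ∷ σ} f g (a ∷ t) = cong (_ ∷_) (mapTuple-∘ f g t)

  mapTuple-id : (t : Tuple A σ) → mapTuple id t ≡ t
  mapTuple-id {σ = []}      []      = refl
  mapTuple-id {σ = str ∷ σ} (a ∷ t) = cong (_ ∷_) (mapTuple-id t)
  mapTuple-id {σ = num ∷ σ} (a ∷ t) = cong (_ ∷_) (mapTuple-id t)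

  mapTuple-fixed : ∀ {f} (t : Tuple A σ) → (∀ {v} → v ∈ entries t → f v ≡ v) → mapTuple f t ≡ t
  mapTuple-fixed t eq = trans (mapTuple-cong t eq) (mapTuple-id t)

  mapTuple-nums : ∀ f k (t : Tuple A (nums k)) → mapTuple f t ≡ t
  mapTuple-nums f k t = mapTuple-fixed t λ v∈ → contradiction (subst (_ ∈_) (entries-nums k t) v∈) λ ()

  mapTuple-injective-at : ∀ {f g} (t : Tuple A σ) → mapTuple f t ≡ mapTuple g t →
                          ∀ {v} → v ∈ entries t → f v ≡ g v
  mapTuple-injective-at {σ = str ∷ σ} (a ∷ t) eq (here refl) = cong (λ { (b ∷ _) → b }) eq
  mapTuple-injective-at {σ = str ∷ σ} (a ∷ t) eq (there v∈)  = mapTuple-injective-at t (cong (λ { (_ ∷ u) → u }) eq) v∈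
  mapTuple-injective-at {σ = num ∷ σ} (a ∷ t) eq v∈          = mapTuple-injective-at t (cong (λ { (_ ∷ u) → u }) eq) v∈

  map-entries : {B : Set} (h : Vertex → B) {f : Vertex → Vertex} → (∀ v → h (f v) ≡ h v) → (t : Tuple A σ) →
                map h (entries (mapTuple f t)) ≡ map h (entries t)
  map-entries {σ = []}      h eq []      = refl
  map-entries {σ = str ∷ σ} h eq (a ∷ t) = cong₂ _∷_ (eq a) (map-entries h eq t)
  map-entries {σ = num ∷ σ} h eq (a ∷ t) = map-entries h eq t

  _⟨_↦_⟩ : Assignment A → Vars σ → Tuple A σ → Assignment A
  α ⟨ u ↦ t ⟩ = _[_≔*_] {A = A} α u t

  infix 4 _≈[_]_

  _≈[_]_ : Assignment A → (Vertex → Vertex) → Assignment A → Set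
  β ≈[ f ] α = ∀ {s} (x : Var s) → β x ≡ mapDom f (α x)

  -- One list covers the values of all structure variables, which replaces any bookkeeping of free
  -- variables; assigning a tuple just prepends its entries.
  within : Assignment A → List Vertex → Set
  within α L = ∀ x → α (sv x) ∈ L

  update-≈ : ∀ {f} {α β : Assignment A} → β ≈[ f ] α → (x : Var s) (a : Dom A s) →
             _[_≔_] {A = A} β x (mapDom f a) ≈[ f ] _[_≔_] {A = A} α x a
  update-≈ eq (sv i) a (sv j) with i ≡ᵇ j
  ... | true  = refl
  ... | false = eq (sv j)
  update-≈ eq (sv i) a (nv j) = eq (nv j)
  update-≈ eq (nv i) a (sv j) = eq (sv j)
  update-≈ eq (nv i) a (nv j) with i ≡ᵇ j
  ... | true  = refl
  ... | false = eq (nv j)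

  updates-≈ : ∀ {f} {α β : Assignment A} → β ≈[ f ] α → (u : Vars σ) (t : Tuple A σ) →
              β ⟨ u ↦ mapTuple f t ⟩ ≈[ f ] α ⟨ u ↦ t ⟩
  updates-≈ eq []      []      = eq
  updates-≈ eq (x ∷ u) (a ∷ t) = updates-≈ (update-≈ eq x a) u t

  updates-within : ∀ {L} {α : Assignment A} → within α L → (u : Vars σ) (t : Tuple A σ) →
                   within (α ⟨ u ↦ t ⟩) (entries t ++ L)
  updates-within {σ = []}      w []         []      = w
  updates-within {σ = str ∷ σ} {L} {α} w (sv i ∷ u) (a ∷ t) x = move (∈-++⁻ (entries t) (updates-within w′ u t x))
    where
    w′ : within (_[_≔_] {A = A} α (sv i) a) (a ∷ L)
    w′ j with i ≡ᵇ j
    ... | true  = here refl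
    ... | false = there (w j)
    move : ∀ {v} → v ∈ entries t ⊎ v ∈ a ∷ L → v ∈ a ∷ entries t ++ L
    move (inj₁ v∈)          = there (∈-++⁺ˡ v∈)
    move (inj₂ (here refl)) = here refl
    move (inj₂ (there v∈))  = there (∈-++⁺ʳ (entries t) v∈)
  updates-within {σ = num ∷ σ} w (nv i ∷ u) (a ∷ t) = updates-within w u t

  values-≈ : ∀ {f} {α β : Assignment A} → β ≈[ f ] α → (u : Vars σ) →
             values {A = A} β u ≡ mapTuple f (values {A = A} α u)
  values-≈ eq []      = refl
  values-≈ eq (x ∷ u) = cong₂ _∷_ (eq x) (values-≈ eq u)

  values-within : ∀ {L} {α : Assignment A} → within α L → (u : Vars σ) → ∀ {v} → v ∈ entries (values {A = A} α u) → v ∈ L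
  values-within {σ = str ∷ σ} w (sv i ∷ u) (here refl) = w i
  values-within {σ = str ∷ σ} w (sv i ∷ u) (there v∈)  = values-within w u v∈
  values-within {σ = num ∷ σ} w (nv i ∷ u) v∈          = values-within w u v∈

-- The two strands, their twists and their automorphisms.

edgeVocabulary : Vocabulary
edgeVocabulary = record { size = 1 ; ar = λ _ → 2 }

module Strands (m n : ℕ) where

  private
    Fibre : ℕ
    Fibre = 2 * suc n

  Node : Set
  Node = Fin (suc m * Fibre)

  abstract

    vertex : Fin (suc m) → Fin 2 → Fin (suc n) → Node
    vertex p x j = combine p (combine x j)

    coordinates : Node → Fin (suc m) × Fin 2 × Fin (suc n)
    coordinates v = proj₁ (remQuot {suc m} Fibre v) , remQuot {2} (suc n) (proj₂ (remQuot {suc m} Fibre v))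

    coordinates-vertex : ∀ p x j → coordinates (vertex p x j) ≡ (p , x , j)
    coordinates-vertex p x j = trans
      (cong (λ c → proj₁ c , remQuot {2} (suc n) (proj₂ c)) (remQuot-combine {suc m} {Fibre} p (combine x j)))
      (cong (p ,_) (remQuot-combine {2} {suc n} x j))

  level : Node → Fin (suc m)
  level v = proj₁ (coordinates v)

  strand : Node → Fin 2
  strand v = proj₁ (proj₂ (coordinates v))

  twin : Node → Fin (suc n)
  twin v = proj₂ (proj₂ (coordinates v))

  abstract

    vertex-coordinates : ∀ v → vertex (level v) (strand v) (twin v) ≡ v
    vertex-coordinates v = trans
      (cong (combine (level v)) (combine-remQuot {2} (suc n) (proj₂ (remQuot {suc m} Fibre v))))
      (combine-remQuot {suc m} Fibre v)

  level-vertex : ∀ p x j → level (vertex p x j) ≡ p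
  level-vertex p x j = cong proj₁ (coordinates-vertex p x j)

  strand-vertex : ∀ p x j → strand (vertex p x j) ≡ x
  strand-vertex p x j = cong (proj₁ ∘ proj₂) (coordinates-vertex p x j)

  twin-vertex : ∀ p x j → twin (vertex p x j) ≡ j
  twin-vertex p x j = cong (proj₂ ∘ proj₂) (coordinates-vertex p x j)

  height : Node → ℕ
  height v = toℕ (level v)

  -- Edges point upwards; the symmetric closure is left to `stc`.
  edge : Node → Node → Bool
  edge u v = (suc (height u) ≡ᵇ height v) ∧ (toℕ (strand u) ≡ᵇ toℕ (strand v))

  G : Structure edgeVocabulary
  -- `suc m * Fibre` reduces to a successor, so the universe of `G` is `Node` definitionally.
  G = record { ∣V∣-1 = pred (suc m * Fibre) ; rel = λ { _ (u ∷ v ∷ []) → edge u v } }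

  flip : Node → Node
  flip v = vertex (level v) (opposite (strand v)) (twin v)

  flip-involutive : ∀ v → flip (flip v) ≡ v
  flip-involutive v
    rewrite coordinates-vertex (level v) (opposite (strand v)) (twin v)
          | opposite-involutive (strand v) = vertex-coordinates v

  height-flip : ∀ v → height (flip v) ≡ height v
  height-flip v = cong toℕ (level-vertex (level v) (opposite (strand v)) (twin v))

  strand-flip : ∀ v → strand (flip v) ≡ opposite (strand v)
  strand-flip v = strand-vertex (level v) (opposite (strand v)) (twin v)

  abstract

    twist : ℕ → Node → Node
    twist q v = if below q (height v) then v else flip v

    twist-below : ∀ {q v} → height v < q → twist q v ≡ v
    twist-below {q} {v} h<q rewrite below-true h<q = refl

    twist-above : ∀ {q v} → q ≤ height v → twist q v ≡ flip v
    twist-above {q} {v} q≤h rewrite below-false q≤h = refl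

    twist-cong : ∀ {q q′ v} → below q (height v) ≡ below q′ (height v) → twist q v ≡ twist q′ v
    twist-cong {v = v} = cong (if_then v else flip v)

    height-twist : ∀ q v → height (twist q v) ≡ height v
    height-twist q v with below q (height v)
    ... | true  = refl
    ... | false = height-flip v

    twist-involutive : ∀ q v → twist q (twist q v) ≡ v
    twist-involutive q v with below q (height v) in eq
    ... | true  rewrite eq = refl
    ... | false rewrite trans (cong (below q) (height-flip v)) eq = flip-involutive v

  opposite-≡ᵇ : (x y : Fin 2) → (toℕ (opposite x) ≡ᵇ toℕ (opposite y)) ≡ (toℕ x ≡ᵇ toℕ y)
  opposite-≡ᵇ zero       zero       = refl
  opposite-≡ᵇ zero       (suc zero) = refl
  opposite-≡ᵇ (suc zero) zero       = refl
  opposite-≡ᵇ (suc zero) (suc zero) = refl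

  -- Only consecutive levels matter, and radius 1 keeps such a pair on one side of the cut, where
  -- `twist` fixes both vertices or flips both.
  edge-twist : ∀ {q u v} → Far 1 q (height u) → Far 1 q (height v) → edge (twist q u) (twist q v) ≡ edge u v
  edge-twist {q} {u} {v} fu fv rewrite height-twist q u | height-twist q v = ∧-congᵀ refl (same fu fv ∘ ≡ᵇ⇒≡ _ _)
    where
    both-above : q ≤ height u → q ≤ height v → (toℕ (strand (twist q u)) ≡ᵇ toℕ (strand (twist q v))) ≡ (toℕ (strand u) ≡ᵇ toℕ (strand v))
    both-above qu qv rewrite twist-above qu | twist-above qv | strand-flip u | strand-flip v = opposite-≡ᵇ (strand u) (strand v)

    same : Far 1 q (height u) → Far 1 q (height v) → suc (height u) ≡ height v →
           (toℕ (strand (twist q u)) ≡ᵇ toℕ (strand (twist q v))) ≡ (toℕ (strand u) ≡ᵇ toℕ (strand v))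
    same (inj₁ hu) _ eq = cong₂ (λ a b → toℕ (strand a) ≡ᵇ toℕ (strand b))
      (twist-below (≤-trans (s≤s (m≤m+n _ 1)) hu)) (twist-below (subst (_< q) (trans (+-comm (height u) 1) eq) hu))
    same (inj₂ qu) (inj₂ qv) eq = both-above (≤-trans (m≤m+n q 1) qu) (≤-trans (m≤m+n q 1) qv)
    same (inj₂ qu) (inj₁ hv) eq = contradiction
      (≤-trans (m≤m+n q 1) qu) (<⇒≱ (≤-trans (s≤s (n≤1+n _)) (≤-trans (≤-reflexive (cong suc eq)) (≤-trans (s≤s (m≤m+n _ 1)) hv))))

  record Automorphism : Set where
    field
      to from   : Node → Node
      to∘from   : ∀ v → to (from v) ≡ v
      from∘to   : ∀ v → from (to v) ≡ v
      edge-to   : ∀ u v → edge (to u) (to v) ≡ edge u v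

  open Automorphism public

  identity : Automorphism
  identity = record
    { to = id ; from = id ; to∘from = λ _ → refl ; from∘to = λ _ → refl ; edge-to = λ _ _ → refl }

  swap : (v w : Node) → level v ≡ level w → strand v ≡ strand w → Automorphism
  swap v w lvl≡ str≡ = record
    { to      = transpose v w
    ; from    = transpose w v
    ; to∘from = λ _ → transpose-inverse v w
    ; from∘to = λ _ → transpose-inverse w v
    ; edge-to = λ x y → cong₂ _∧_
        (cong₂ (λ i j → suc i ≡ᵇ j) (transpose-invariant height (cong toℕ lvl≡) x) (transpose-invariant height (cong toℕ lvl≡) y))
        (cong₂ (λ i j → toℕ i ≡ᵇ toℕ j) (transpose-invariant strand str≡ x) (transpose-invariant strand str≡ y))
    }

  -- Combining cut and automorphism in one family makes a single induction hypothesis yield both the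
  -- comparison across a cut and the invariance under swaps of twins that bounds in-degrees from
  -- below.
  act : Automorphism → ℕ → Node → Node
  act g q = to g ∘ twist q

  act-injective : ∀ g q {u v} → act g q u ≡ act g q v → u ≡ v
  act-injective g q {u} {v} eq = begin
    u                      ≡⟨ twist-involutive q u ⟨
    twist q (twist q u)    ≡⟨ cong (twist q) (trans (sym (from∘to g _)) (trans (cong (from g) eq) (from∘to g _))) ⟩
    twist q (twist q v)    ≡⟨ twist-involutive q v ⟩
    v                      ∎
    where open ≡-Reasoning

-- Matched assignments and bijections with tuple-dependent cuts.

module Indistinguishability (m n : ℕ) where
  open Strands m n
  open Tuples G

  heights : Tuple G σ → List ℕ
  heights t = map height (entries t)

  length-heights : (t : Tuple G σ) → length (heights t) ≤ length σ
  length-heights t = ≤-trans (≤-reflexive (length-map height (entries t))) (length-entries t)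

  heights-twist : ∀ q (t : Tuple G σ) → heights (mapTuple (twist q) t) ≡ heights t
  heights-twist q = map-entries height (height-twist q)

  -- The cut depends on a tuple only through its levels, which `twist` preserves; the image thus
  -- reveals the cut that was used, and the map can be inverted. `from g` is undone first, since
  -- nothing is assumed about how `g` acts on levels.
  spread unspread : Automorphism → (List ℕ → ℕ) → Tuple G σ → Tuple G σ
  spread g cut t   = mapTuple (act g (cut (heights t))) t
  unspread g cut t = mapTuple (twist (cut (heights (mapTuple (from g) t)))) (mapTuple (from g) t)

  unspread-spread : ∀ g cut (t : Tuple G σ) → unspread g cut (spread g cut t) ≡ t
  unspread-spread g cut t
    rewrite mapTuple-∘ (from g) (act g (cut (heights t))) t
          | mapTuple-cong {f = from g ∘ act g (cut (heights t))} {g = twist (cut (heights t))} t (λ _ → from∘to g _)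
          | heights-twist (cut (heights t)) t
          | mapTuple-∘ (twist (cut (heights t))) (twist (cut (heights t))) t
    = mapTuple-fixed t (λ _ → twist-involutive _ _)

  spread-unspread : ∀ g cut (t : Tuple G σ) → spread g cut (unspread g cut t) ≡ t
  spread-unspread g cut t
    rewrite heights-twist (cut (heights (mapTuple (from g) t))) (mapTuple (from g) t)
          | mapTuple-∘ (act g (cut (heights (mapTuple (from g) t)))) (twist (cut (heights (mapTuple (from g) t)))) (mapTuple (from g) t)
          | mapTuple-cong {f = act g (cut (heights (mapTuple (from g) t))) ∘ twist (cut (heights (mapTuple (from g) t)))} {g = to g}
              (mapTuple (from g) t) (λ _ → cong (to g) (twist-involutive _ _))
          | mapTuple-∘ (to g) (from g) t
    = mapTuple-fixed t (λ _ → to∘from g _)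

  record Matched (r : ℕ) (L : List Node) (g : Automorphism) (q : ℕ) (α β : Assignment G) : Set where
    field
      far    : ∀ {v} → v ∈ L → Far r q (height v)
      inside : within α L
      image  : β ≈[ act g q ] α

  open Matched

  private
    variable
      r r′ q K : ℕ
      L : List Node
      g : Automorphism
      α β : Assignment G

  weaken : r′ ≤ r → Matched r L g q α β → Matched r′ L g q α β
  weaken r′≤r M = record { far = Far-weaken r′≤r ∘ far M ; inside = inside M ; image = image M }

  -- The old and the new twist agree on `L`, since its vertices stay on their sides of the cut.
  recut : ∀ {q′} → (∀ {v} → v ∈ L → Far r′ q′ (height v) × below q′ (height v) ≡ below q (height v)) →
          Matched r L g q α β → Matched r′ L g q′ α β
  recut {g = g} clear M = record
    { far    = proj₁ ∘ clear
    ; inside = inside M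
    ; image  = λ { (sv i) → trans (image M (sv i)) (cong (to g) (twist-cong (sym (proj₂ (clear (inside M i))))))
                 ; (nv i) → image M (nv i) }
    }

  assign : Matched r L g q α β → (u : Vars σ) (t : Tuple G σ) → (∀ {v} → v ∈ entries t → Far r q (height v)) →
           Matched r (entries t ++ L) g q (α ⟨ u ↦ t ⟩) (β ⟨ u ↦ mapTuple (act g q) t ⟩)
  assign M u t far-t = record
    { far    = λ v∈ → [ far-t , far M ]′ (∈-++⁻ (entries t) v∈)
    ; inside = updates-within (inside M) u t
    ; image  = updates-≈ (image M) u t
    }

  length-entries-++ : (t : Tuple G σ) → length L ≤ K → length (entries t ++ L) ≤ length σ + K
  length-entries-++ t L≤K = ≤-trans (≤-reflexive (length-++ (entries t))) (+-mono-≤ (length-entries t) L≤K)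

  module _ (t : Tuple G σ) where

    cut-keeps : ∀ {x} → Far (3 ^ length σ * r) q x →
                Far r (relocate r q (heights t)) x × below (relocate r q (heights t)) x ≡ below q x
    cut-keeps {r = r} = relocate-keeps (heights t) ∘ Far-weaken (*-monoˡ-≤ r (^-monoʳ-≤ 3 (length-heights t)))

    cut-far : ∀ {v} → v ∈ entries t → Far r (relocate r q (heights t)) (height v)
    cut-far v∈ = relocate-far (heights t) (∈-map⁺ height v∈)

    cut-fixed : (∀ {v} → v ∈ entries t → Far (3 ^ length σ * r) q (height v)) → relocate r q (heights t) ≡ q
    cut-fixed {r = r} {q = q} far-t = relocate-fixed (heights t) λ h∈ → far-h (∈-map⁻ height h∈)
      where
      far-h : ∀ {h} → (∃ λ v → v ∈ entries t × h ≡ height v) → Far (3 ^ length (heights t) * r) q h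
      far-h (v , v∈ , refl) = Far-weaken (*-monoˡ-≤ r (^-monoʳ-≤ 3 (length-heights t))) (far-t v∈)

  -- The bound `K` on the number of parameters serves `lrec`, where enough twins of a vertex must
  -- lie outside them.
  Invariant : ℕ → ℕ → Formula edgeVocabulary → Set
  Invariant K r φ = ∀ {L g q} {α β : Assignment G} → length L ≤ K → Matched r L g q α β → eval G α φ ≡ eval G β φ

  Invariant-weaken : ∀ φ → r ≤ r′ → Invariant K r φ → Invariant K r′ φ
  Invariant-weaken φ r≤r′ inv L≤K M = inv L≤K (weaken r≤r′ M)

  -- The cut first moves away from the levels of `t`, at the price of a factor `3 ^ length σ` in its
  -- distance from `L`; then `t` can be assigned.
  spread-invariant : ∀ φ → Invariant (length σ + K) r φ → length L ≤ K → Matched (3 ^ length σ * r) L g q α β →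
                     (u : Vars σ) (t : Tuple G σ) →
                     eval G (α ⟨ u ↦ t ⟩) φ ≡ eval G (β ⟨ u ↦ spread g (relocate r q) t ⟩) φ
  spread-invariant φ inv L≤K M u t =
    inv (length-entries-++ t L≤K) (assign (recut (cut-keeps t ∘ far M) M) u t (cut-far t))

  any-invariant : ∀ φ → Invariant (suc K) r φ → length L ≤ K → Matched (3 * r) L g q α β → (x : Var s) →
                  any (λ a → eval G (_[_≔_] {A = G} α x a) φ) (allFin (card G s)) ≡
                  any (λ a → eval G (_[_≔_] {A = G} β x a) φ) (allFin (card G s))
  any-invariant {r = r} {g = g} {q = q} {s = s} φ inv L≤K M x =
    any-bijection ∈-allFin {f = single (spread g (relocate r q))} {g = single (unspread g (relocate r q))}
      (λ a → cong All.head (unspread-spread g (relocate r q) (a ∷ [])))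
      (λ a → cong All.head (spread-unspread g (relocate r q) (a ∷ [])))
      (λ a → spread-invariant φ inv L≤K M (x ∷ []) (a ∷ []))
    where
    single : (Tuple G (s ∷ []) → Tuple G (s ∷ [])) → Dom G s → Dom G s
    single f a = All.head (f (a ∷ []))

-- The recursion of `lrec` under a moving cut.

-- The exponent `t` bounds how many divisions by in-degrees of at least `N` the resource can
-- survive.
division-drop : ∀ {ℓ d N} t → N ≤ d → suc ℓ < N ^ t → ∃ λ t′ → suc t′ ≡ t × ℓ /₀ d < N ^ t′
division-drop zero _ (s≤s ())
-- The junk value of `/₀` cannot occur: `d = 0` forces `N = 0`, and no resource is below a positive
-- power of `0`.
division-drop {d = zero} (suc t) z≤n ()
division-drop {ℓ} {suc d} {N} (suc t) N≤d ℓ<N^t = t , refl , m<n*o⇒m/o<n (begin-strict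
  ℓ              <⟨ n<1+n ℓ ⟩
  suc ℓ          <⟨ ℓ<N^t ⟩
  N * N ^ t      ≤⟨ *-monoˡ-≤ (N ^ t) N≤d ⟩
  suc d * N ^ t  ≡⟨ *-comm (suc d) (N ^ t) ⟩
  N ^ t * suc d  ∎)
  where open ≤-Reasoning

-- One factor 3 ^ k for each unit of the rank ρ, one for moving the cut away from
-- a successor b, and one for moving it away from the tuples counted by the in-degree of b.
lrecRadius : ℕ → ℕ → ℕ → ℕ
lrecRadius r k ρ = (3 ^ k) ^ suc (suc ρ) * r

module LrecInvariance (m n : ℕ) where
  open Strands m n
  open Tuples G
  open Indistinguishability m n
  open Matched

  module _ {σ : List Sort} {k : ℕ} (u v : Vars σ) (p : Vars (nums (suc k))) (φE φC : Formula edgeVocabulary) where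

    -- `E` and `C` repeat the local definitions in `eval`, so that `X` is definitionally the
    -- relation evaluated for an `lrec` formula.
    E : Assignment G → Tuple G σ → Tuple G σ → Bool
    E α a b = eval G ((α ⟨ u ↦ a ⟩) ⟨ v ↦ b ⟩) φE

    C : Assignment G → Tuple G σ → ℕ → Bool
    C α a i = any (λ t → (number G (suc k) t ≡ᵇ i) ∧ eval G ((α ⟨ u ↦ a ⟩) ⟨ p ↦ t ⟩) φC) (tuples G (nums (suc k)))

    X : Assignment G → Tuple G σ → ℕ → Bool
    X α = Recursion.X (tuples G σ) (E α) (C α)

    indegree : Assignment G → Tuple G σ → ℕ
    indegree α = Recursion.indegree (tuples G σ) (E α) (C α)

    module _ {r K N : ℕ}
             (invE : Invariant (length σ + (length σ + K)) r φE)
             (invC : Invariant (length (nums (suc k)) + (length σ + K)) r φC)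
             (room : N + (length σ + K) ≤ suc n)
             {L : List Node} (L≤K : length L ≤ K) where

      E-matched : ∀ {g q} {α β : Assignment G} → Matched r L g q α β → (a b : Tuple G σ) →
                  (∀ {x} → x ∈ entries a → Far r q (height x)) → (∀ {x} → x ∈ entries b → Far r q (height x)) →
                  E α a b ≡ E β (mapTuple (act g q) a) (mapTuple (act g q) b)
      E-matched M a b fa fb = invE (length-entries-++ b (length-entries-++ a L≤K)) (assign (assign M u a fa) v b
        (λ {x} → fb {x}))

      C-matched : ∀ {g q} {α β : Assignment G} → Matched r L g q α β → (a : Tuple G σ) →
                  (∀ {x} → x ∈ entries a → Far r q (height x)) → ∀ i →
                  C α a i ≡ C β (mapTuple (act g q) a) i
      C-matched {g} {q} {β = β} M a fa i = any-cong (λ t → cong (_ ∧_) (trans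
        (invC (length-entries-++ t (length-entries-++ a L≤K)) (assign (assign M u a fa) p t
          (λ x∈ → contradiction (subst (_ ∈_) (entries-nums (suc k) t) x∈) λ ())))
        (cong (λ t′ → eval G ((β ⟨ u ↦ mapTuple (act g q) a ⟩) ⟨ p ↦ t′ ⟩) φC) (mapTuple-nums (act g q) (suc k) t))))
        (tuples G (nums (suc k)))

      -- Predecessors are counted through `spread`: the cut moves away from each `a`, while `b` is
      -- far enough to stay on its side and keep its image.
      indegree-matched : ∀ {g q} {α β : Assignment G} → Matched (3 ^ length σ * r) L g q α β → (b : Tuple G σ) →
                         (∀ {x} → x ∈ entries b → Far (3 ^ length σ * r) q (height x)) →
                         indegree α b ≡ indegree β (mapTuple (act g q) b)
      indegree-matched {g} {q} {β = β} M b fb =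
        count-bijection (∈-tuples G) {f = spread g (relocate r q)} {g = unspread g (relocate r q)}
          (unspread-spread g (relocate r q)) (spread-unspread g (relocate r q))
          (λ a → trans
            (E-matched (recut (cut-keeps a ∘ far M) M) a b (cut-far a) (proj₁ ∘ cut-keeps a ∘ fb))
            (cong (E β (spread g (relocate r q) a))
              (mapTuple-cong b λ x∈ → cong (to g) (twist-cong (proj₂ (cut-keeps a (fb x∈)))))))
          (tuples! G σ)

      -- Swapping `w` with a twin outside `entries b ++ L` fixes `b` and all parameters, so it sends
      -- `a` to a predecessor of `b`. Different twins give different predecessors, and by `room` at
      -- least `N` twins are available.
      indegree-large : ∀ {α : Assignment G} → within α L → (a b : Tuple G σ) → T (E α a b) →
                       ∀ {w} → w ∈ entries a → w ∉ entries b ++ L → N ≤ indegree α b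
      indegree-large {α} α∈L a b Eab {w} w∈a w∉B = ≤-trans
        (+-cancelʳ-≤ (length σ + K) N kept (≤-trans room suc-n≤))
        (count-mono-injective (∈-tuples G) (allFin⁺ (suc n)) image-a image-a-injective edge-image-a)
        where
        open DecMembership (_≟_ {suc m * (2 * suc n)}) using (_∈?_)

        B : List Node
        B = entries b ++ L

        -- A cut above all levels: twist q₀ is the identity, and E-matched becomes
        -- invariance of E under automorphisms.
        q₀ : ℕ
        q₀ = suc (m + r)

        height<q₀ : ∀ x → height x + r < q₀
        height<q₀ x = s≤s (+-monoˡ-≤ r (toℕ≤pred[n] (level x)))

        sibling : Fin (suc n) → Node
        sibling j = vertex (level w) (strand w) j

        swap-sibling : Fin (suc n) → Automorphism
        swap-sibling j = swap w (sibling j) (sym (level-vertex _ _ _)) (sym (strand-vertex _ _ _))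

        act-swap : ∀ j x → act (swap-sibling j) q₀ x ≡ transpose w (sibling j) x
        act-swap j x = cong (transpose w (sibling j)) (twist-below (≤-trans (s≤s (m≤m+n _ r)) (height<q₀ x)))

        image-a : Fin (suc n) → Tuple G σ
        image-a j = mapTuple (act (swap-sibling j) q₀) a

        image-a-injective : ∀ {i j} → image-a i ≡ image-a j → i ≡ j
        image-a-injective {i} {j} eq = begin
          i                                     ≡⟨ twin-vertex _ _ i ⟨
          twin (sibling i)                      ≡⟨ cong twin (trans (act-swap i w) (transpose-i w _)) ⟨
          twin (act (swap-sibling i) q₀ w)      ≡⟨ cong twin (mapTuple-injective-at a eq w∈a) ⟩
          twin (act (swap-sibling j) q₀ w)      ≡⟨ cong twin (trans (act-swap j w) (transpose-i w _)) ⟩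
          twin (sibling j)                      ≡⟨ twin-vertex _ _ j ⟩
          j                                     ∎
          where open ≡-Reasoning

        keep : Fin (suc n) → Bool
        keep j = not (does (sibling j ∈? B))

        kept : ℕ
        kept = count (allFin (suc n)) keep

        keep⇒∉ : ∀ j → T (keep j) → sibling j ∉ B
        keep⇒∉ j _ j∈ with sibling j ∈? B
        keep⇒∉ j () j∈ | yes _
        ... | no j∉ = j∉ j∈

        keep-or-∈ : ∀ j → T (keep j) ⊎ sibling j ∈ B
        keep-or-∈ j with sibling j ∈? B
        ... | yes j∈ = inj₂ j∈
        ... | no  _  = inj₁ _

        fixed : ∀ j → T (keep j) → ∀ {x} → x ∈ B → act (swap-sibling j) q₀ x ≡ x
        fixed j kj x∈ = trans (act-swap j _)
          (transpose-fixed (λ { refl → w∉B x∈ }) (λ { refl → keep⇒∉ j kj x∈ }))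

        matched : ∀ j → T (keep j) → Matched r L (swap-sibling j) q₀ α α
        matched j kj = record
          { far    = λ {x} _ → inj₁ (height<q₀ x)
          ; inside = α∈L
          ; image  = λ { (sv i) → sym (fixed j kj (∈-++⁺ʳ (entries b) (α∈L i))) ; (nv i) → refl }
          }

        edge-image-a : ∀ j → T (keep j) → T (E α (image-a j) b)
        edge-image-a j kj = subst T (trans
          (E-matched (matched j kj) a b (λ {x} _ → inj₁ (height<q₀ x)) (λ {x} _ → inj₁ (height<q₀ x)))
          (cong (E α (image-a j)) (mapTuple-fixed b (fixed j kj ∘ ∈-++⁺ˡ)))) Eab

        covered : allFin (suc n) ⊆ filterᵇ keep (allFin (suc n)) ++ map twin B
        covered {j} _ with keep-or-∈ j
        ... | inj₁ kj = ∈-++⁺ˡ (∈-filter⁺ (T? ∘ keep) (∈-allFin j) kj)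
        -- An excluded sibling is recovered from its index, so `B` excludes at most `length B`
        -- indices.
        ... | inj₂ j∈ = ∈-++⁺ʳ _ (subst (_∈ map twin B) (twin-vertex _ _ j) (∈-map⁺ twin j∈))

        suc-n≤ : suc n ≤ kept + (length σ + K)
        suc-n≤ = begin
          suc n                             ≡⟨ length-tabulate id ⟨
          length (allFin (suc n))           ≤⟨ length-mono-⊆ (allFin⁺ (suc n)) covered ⟩
          length (filterᵇ keep (allFin (suc n)) ++ map twin B) ≡⟨ length-++ (filterᵇ keep (allFin (suc n))) ⟩
          kept + length (map twin B)        ≡⟨ cong (kept +_) (length-map twin B) ⟩
          kept + length B                   ≤⟨ +-monoʳ-≤ kept (length-entries-++ b L≤K) ⟩
          kept + (length σ + K)             ∎
          where open ≤-Reasoning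

      private
        rad : ℕ → ℕ
        rad = lrecRadius r (length σ)

        -- Encodes the lexicographic order on pairs with `e ≤ length σ`: lowering `t` pays for
        -- resetting `e` to `length σ`.
        rank : ℕ → ℕ → ℕ
        rank t e = t * suc (length σ) + e

      module _ {g : Automorphism} {α β : Assignment G} where

        -- At most t steps of large in-degree remain. S consists of entries of a that
        -- persist until the next such step; at most e more can join them.
        X-matched : ∀ ℓ → Acc _<_ ℓ → ∀ t e (S : List Node) {q} (a : Tuple G σ) → ℓ < N ^ t →
                    Unique S → S ⊆ entries a → (∀ {x} → x ∈ S → x ∉ L) → length S + e ≡ length σ →
                    Matched (rad (rank t e)) L g q α β →
                    (∀ {x} → x ∈ entries a → Far (rad (rank t e)) q (height x)) →
                    X α a ℓ ≡ X β (mapTuple (act g q) a) ℓ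
        X-matched zero    _        t e S a ℓ< S! S⊆a S∉L |S| M fa = refl
        X-matched (suc ℓ) (acc rs) t e S {q} a ℓ< S! S⊆a S∉L |S| M fa = begin
          X α a (suc ℓ)                     ≡⟨ Recursion.X-suc (tuples G σ) (E α) (C α) a ℓ ⟩
          C α a (count (tuples G σ) (λ b → E α a b ∧ X α b (ℓ /₀ indegree α b)))
            ≡⟨ C-matched (weaken (r≤rad) M) a (Far-weaken (r≤rad) ∘ fa) _ ⟩
          C β a′ (count (tuples G σ) (λ b → E α a b ∧ X α b (ℓ /₀ indegree α b)))
            ≡⟨ cong (C β a′) (count-bijection (∈-tuples G)
                 (unspread-spread g (relocate r′ q)) (spread-unspread g (relocate r′ q))
                 -- The values of `X` are compared only along an actual edge from `a` to `b`, as the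
                 -- bound on the in-degree requires.
                 (λ b → ∧-congᵀ (E-eq b) (X-eq b)) (tuples! G σ)) ⟩
          C β a′ (count (tuples G σ) (λ b → E β a′ b ∧ X β b (ℓ /₀ indegree β b)))
            ≡⟨ Recursion.X-suc (tuples G σ) (E β) (C β) a′ ℓ ⟨
          X β a′ (suc ℓ)                    ∎
          where
          open ≡-Reasoning
          open DecMembership (_≟_ {suc m * (2 * suc n)}) using (_∈?_)

          Q : ℕ
          Q = 3 ^ length σ

          instance
            Q≢0 : NonZero Q
            Q≢0 = m^n≢0 3 (length σ)

          r≤rad : r ≤ rad (rank t e)
          r≤rad = m≤n*m r (Q ^ suc (suc (rank t e))) {{m^n≢0 Q (suc (suc (rank t e)))}}

          a′ : Tuple G σ
          a′ = mapTuple (act g q) a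

          -- `rad (rank t e)` is `Q * r′`. Moving the cut away from `b` spends one factor `Q`, and
          -- `r′` still suffices for every smaller rank and for the in-degree.
          r′ : ℕ
          r′ = Q ^ suc (rank t e) * r

          M₁ : Matched (Q * r′) L g q α β
          M₁ = weaken (≤-reflexive (sym (*-assoc Q (Q ^ suc (rank t e)) r))) M

          fa₁ : ∀ {x} → x ∈ entries a → Far (Q * r′) q (height x)
          fa₁ = Far-weaken (≤-reflexive (sym (*-assoc Q (Q ^ suc (rank t e)) r))) ∘ fa

          r≤r′ : r ≤ r′
          r≤r′ = m≤n*m r (Q ^ suc (rank t e)) {{m^n≢0 Q (suc (rank t e))}}

          Qr≤r′ : Q * r ≤ r′
          Qr≤r′ = *-monoˡ-≤ r (m≤m*n Q (Q ^ rank t e) {{m^n≢0 Q (rank t e)}})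

          module _ (b : Tuple G σ) where

            cut : ℕ
            cut = relocate r′ q (heights b)

            b′ : Tuple G σ
            b′ = mapTuple (act g cut) b

            Mb : Matched r′ L g cut α β
            Mb = recut (cut-keeps b ∘ far M₁) M₁

            E-eq : E α a b ≡ E β a′ b′
            E-eq = trans
              (E-matched (weaken r≤r′ Mb) a b (Far-weaken r≤r′ ∘ proj₁ ∘ cut-keeps b ∘ fa₁) (Far-weaken r≤r′ ∘ cut-far b))
              (cong (λ c → E β c b′) (mapTuple-cong a λ x∈ → cong (to g) (twist-cong (proj₂ (cut-keeps b (fa₁ x∈))))))

            ℓ′ : ℕ
            ℓ′ = ℓ /₀ indegree α b

            ℓ′<suc-ℓ : ℓ′ < suc ℓ
            ℓ′<suc-ℓ = s≤s (/₀-≤ ℓ (indegree α b))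

            descend : ∀ t′ e′ S′ → suc (rank t′ e′) ≤ rank t e → ℓ′ < N ^ t′ →
                      Unique S′ → S′ ⊆ entries b → (∀ {x} → x ∈ S′ → x ∉ L) → length S′ + e′ ≡ length σ →
                      X α b ℓ′ ≡ X β b′ ℓ′
            descend t′ e′ S′ drop ℓ′< S′! S′⊆b S′∉L |S′| =
              X-matched ℓ′ (rs ℓ′<suc-ℓ) t′ e′ S′ b ℓ′< S′! S′⊆b S′∉L |S′| (weaken le Mb) (Far-weaken le ∘ cut-far b)
              where
              le : rad (rank t′ e′) ≤ r′
              le = *-monoˡ-≤ r (^-monoʳ-≤ Q (s≤s drop))

            persist : All (_∈ entries b ++ L) (entries a) → S ⊆ entries b
            persist a⊆ x∈ =
              [ id , (λ x∈L → contradiction x∈L (S∉L x∈)) ]′ (∈-++⁻ (entries b) (All.lookup a⊆ (S⊆a x∈)))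

            next : T (E α a b) → X α b ℓ′ ≡ X β b′ ℓ′
            next Eab with All.all? (_∈? (entries b ++ L)) (entries a)
            -- An entry of `a` is lost: the in-degree of `b` is large, `t` drops, and the set of
            -- persistent entries restarts empty.
            ... | no ¬all with find (¬All⇒Any¬ (_∈? (entries b ++ L)) (entries a) ¬all)
            ...   | w , w∈a , w∉ with division-drop t (indegree-large (inside M) a b Eab w∈a w∉) ℓ<
            ...   | t′ , refl , ℓ′< =
              descend t′ (length σ) [] (s≤s (≤-trans (≤-reflexive (+-comm (t′ * suc (length σ)) (length σ))) (m≤m+n _ e)))
                ℓ′< [] (λ ()) (λ ()) refl
            next Eab | yes a⊆ with All.all? (_∈? (S ++ L)) (entries b)
            -- All entries of `b` lie in `S` or `L`, so the cut is already far from them. Cut and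
            -- rank are unchanged; only the resource decreases.
            ... | yes b⊆ = subst (λ c → X α b ℓ′ ≡ X β (mapTuple (act g c) b) ℓ′) (sym (cut-fixed b fb))
              (X-matched ℓ′ (rs ℓ′<suc-ℓ) t e S b (<-trans ℓ′<suc-ℓ ℓ<) S! (persist a⊆) S∉L |S| M
                (Far-weaken (≤-reflexive (*-assoc Q (Q ^ suc (rank t e)) r)) ∘ fb))
              where
              fb : ∀ {x} → x ∈ entries b → Far (Q * r′) q (height x)
              fb x∈ = [ fa₁ ∘ S⊆a , far M₁ ]′ (∈-++⁻ S (All.lookup b⊆ x∈))
            -- A new entry `w` of `b` joins the persistent ones, and `e` drops.
            ... | no ¬old with find (¬All⇒Any¬ (_∈? (S ++ L)) (entries b) ¬old)
            ...   | w , w∈b , w∉ =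
              descend t (pred e) (w ∷ S) (≤-reflexive (trans (sym (+-suc _ (pred e))) (cong (t * suc (length σ) +_) e≡)))
                (<-trans ℓ′<suc-ℓ ℓ<) wS! wS⊆b wS∉L
                (trans (sym (+-suc (length S) (pred e))) (trans (cong (length S +_) e≡) |S|))
              where
              wS! : Unique (w ∷ S)
              wS! = All.tabulate (λ { x∈ refl → w∉ (∈-++⁺ˡ x∈) }) ∷ S!
              wS⊆b : w ∷ S ⊆ entries b
              wS⊆b (here refl) = w∈b
              wS⊆b (there x∈)  = persist a⊆ x∈
              wS∉L : ∀ {x} → x ∈ w ∷ S → x ∉ L
              wS∉L (here refl) = w∉ ∘ ∈-++⁺ʳ S
              wS∉L (there x∈)  = S∉L x∈
              -- `w ∷ S` lists distinct entries of `b`, of which there are at most `length σ`, so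
              -- `S` alone falls short of that number.
              1≤e : 1 ≤ e
              1≤e = +-cancelˡ-≤ (length S) 1 e (≤-trans (≤-reflexive (+-comm (length S) 1))
                (≤-trans (length-mono-⊆ wS! wS⊆b) (≤-trans (length-entries b) (≤-reflexive (sym |S|)))))
              e≡ : suc (pred e) ≡ e
              e≡ = suc-pred e {{>-nonZero 1≤e}}

            X-eq : T (E α a b) → X α b (ℓ /₀ indegree α b) ≡ X β b′ (ℓ /₀ indegree β b′)
            X-eq Eab = trans (next Eab) (cong (λ d → X β b′ (ℓ /₀ d))
              (indegree-matched (weaken Qr≤r′ Mb) b (Far-weaken Qr≤r′ ∘ cut-far b)))

-- Powers of the universe size against powers of the available twins.

*-^-comm : ∀ m n k → (m * n) ^ k ≡ m ^ k * n ^ k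
*-^-comm m n zero    = refl
*-^-comm m n (suc k) = trans (cong (m * n *_) (*-^-comm m n k)) ([m*n]*[o*p]≡[m*o]*[n*p] m n (m ^ k) (n ^ k))

base : ℕ → ℕ → ℕ
base m K = suc (suc m * (2 * suc K))

-- With N = n + 1 ∸ K, the universe size is at most base m K * N − 1, so a power of it is below the next power of N
-- as soon as N exceeds the matching power of the base.
universe-power-bound : ∀ m n K l → base m K ^ l + K ≤ n →
       ∃ λ N → N + K ≤ suc n × suc (suc m * (2 * suc n)) ^ l ≤ N ^ suc l
universe-power-bound m n K l large = N , ≤-reflexive N+K≡ , (begin
  suc (suc m * (2 * suc n)) ^ l   ≤⟨ ^-monoˡ-≤ l universe ⟩
  (base m K * N) ^ l              ≡⟨ *-^-comm (base m K) N l ⟩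
  base m K ^ l * N ^ l            ≤⟨ *-monoˡ-≤ (N ^ l) powers ⟩
  N * N ^ l                       ∎)
  where
  open ≤-Reasoning
  N : ℕ
  N = suc n ∸ K
  N+K≡ : N + K ≡ suc n
  N+K≡ = m∸n+n≡m (≤-trans (m≤n+m K _) (m≤n⇒m≤1+n large))
  powers : base m K ^ l ≤ N
  powers = +-cancelʳ-≤ K _ _ (≤-trans (m≤n⇒m≤1+n large) (≤-reflexive (sym N+K≡)))
  1≤N : 1 ≤ N
  1≤N = ≤-trans (m^n>0 (base m K) l) powers
  instance
    N≢0 : NonZero N
    N≢0 = >-nonZero 1≤N
  universe : suc (suc m * (2 * suc n)) ≤ base m K * N
  universe = begin
    suc (suc m * (2 * suc n))             ≡⟨ cong (λ z → suc (suc m * (2 * z))) N+K≡ ⟨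
    -- `1 ≤ N` absorbs the leading successor and turns `K` into `K * N`, so that `N` can be factored
    -- out.
    suc (suc m * (2 * (N + K)))           ≤⟨ +-mono-≤ 1≤N (*-monoʳ-≤ (suc m) (*-monoʳ-≤ 2 (+-monoʳ-≤ N (m≤m*n K N)))) ⟩
    N + suc m * (2 * (suc K * N))         ≡⟨ cong (λ z → N + suc m * z) (*-assoc 2 (suc K) N) ⟨
    N + suc m * (2 * suc K * N)           ≡⟨ cong (N +_) (*-assoc (suc m) (2 * suc K) N) ⟨
    base m K * N                          ∎

-- Invariance of every formula of `LREC`.

-- Depends on the formula alone, so the length of the paths can be chosen from it before the number
-- of twins is fixed.
radius : ∀ {τ} → Formula τ → ℕ
radius (atom R us)  = 1
radius (x ≐ y)      = 0
radius (x ≤ᶠ y)     = 0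
radius (¬ᶠ φ)       = radius φ
radius (φ ∧ᶠ ψ)     = radius φ + radius ψ
radius (φ ∨ᶠ ψ)     = radius φ + radius ψ
radius (∃ᶠ x ∙ φ)   = 3 * radius φ
radius (∀ᶠ x ∙ φ)   = 3 * radius φ
radius (# {σ} u φ q) = 3 ^ length σ * radius φ
radius (lrec {σ} {k} {l} u v q φE φC w r) =
  -- The last argument is the starting rank, with `t = suc (suc l)` and `e = length σ`: a resource
  -- of `suc l` digits is below `N ^ suc (suc l)`.
  lrecRadius (radius φE + radius φC) (length σ) (suc (suc l) * suc (length σ) + length σ)

-- Lower bound on `n` for paths of length `m` and `K` parameters. The final summand for `lrec` is
-- the hypothesis of `universe-power-bound` with exponent `suc l`.
threshold : ∀ {τ} → ℕ → Formula τ → ℕ → ℕ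
threshold m (atom R us)  K = 0
threshold m (x ≐ y)      K = 0
threshold m (x ≤ᶠ y)     K = 0
threshold m (¬ᶠ φ)       K = threshold m φ K
threshold m (φ ∧ᶠ ψ)     K = threshold m φ K + threshold m ψ K
threshold m (φ ∨ᶠ ψ)     K = threshold m φ K + threshold m ψ K
threshold m (∃ᶠ x ∙ φ)   K = threshold m φ (suc K)
threshold m (∀ᶠ x ∙ φ)   K = threshold m φ (suc K)
threshold m (# {σ} u φ q) K = threshold m φ (length σ + K)
threshold m (lrec {σ} {k} {l} u v q φE φC w r) K =
  threshold m φE (length σ + (length σ + K)) +
  (threshold m φC (length (nums (suc k)) + (length σ + K)) +
   (base m (length σ + K) ^ suc l + (length σ + K)))

module Invariance (m n : ℕ) where
  open Strands m n
  open Tuples G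
  open Indistinguishability m n
  open Matched

  number-matched : ∀ {f k} {α β : Assignment G} → β ≈[ f ] α → (q : Vars (nums k)) →
                   number G k (values {A = G} α q) ≡ number G k (values {A = G} β q)
  number-matched {f} {k} eq q = cong (number G k) (sym (trans (values-≈ eq q) (mapTuple-nums f k _)))

  invariant : ∀ φ K → threshold m φ K ≤ n → Invariant K (radius φ) φ
  invariant (atom zero (x ∷ y ∷ [])) K _ {g = g} L≤K M
    rewrite image M x | image M y =
    sym (trans (edge-to g _ _) (edge-twist (far M (in-L x)) (far M (in-L y))))
    where
    in-L : ∀ x → _ ∈ _
    in-L (sv i) = inside M i
  invariant (_≐_ {str} x y) K _ {g = g} {q = q} L≤K M rewrite image M x | image M y =
    T-ext (λ t → ≡⇒≡ᵇ _ _ (cong (toℕ ∘ act g q) (toℕ-injective (≡ᵇ⇒≡ _ _ t))))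
          (λ t → ≡⇒≡ᵇ _ _ (cong toℕ (act-injective g q (toℕ-injective (≡ᵇ⇒≡ _ _ t)))))
  invariant (_≐_ {num} x y) K _ L≤K M rewrite image M x | image M y = refl
  invariant (x ≤ᶠ y) K _ L≤K M rewrite image M x | image M y = refl
  invariant (¬ᶠ φ) K large L≤K M = cong not (invariant φ K large L≤K M)
  invariant (φ ∧ᶠ ψ) K large L≤K M = cong₂ _∧_
    (invariant φ K (m+n≤o⇒m≤o _ large) L≤K (weaken (m≤m+n _ _) M))
    (invariant ψ K (m+n≤o⇒n≤o _ large) L≤K (weaken (m≤n+m _ _) M))
  invariant (φ ∨ᶠ ψ) K large L≤K M = cong₂ _∨_
    (invariant φ K (m+n≤o⇒m≤o _ large) L≤K (weaken (m≤m+n _ _) M))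
    (invariant ψ K (m+n≤o⇒n≤o _ large) L≤K (weaken (m≤n+m _ _) M))
  invariant (∃ᶠ x ∙ φ) K large L≤K M = any-invariant φ (invariant φ (suc K) large) L≤K M x
  invariant (∀ᶠ_∙_ {s} x φ) K large {α = α} {β} L≤K M = begin
    all (λ a → eval G (_[_≔_] {A = G} α x a) φ) (allFin (card G s))        ≡⟨ all≡not-any-not _ (allFin (card G s)) ⟩
    not (any (λ a → eval G (_[_≔_] {A = G} α x a) (¬ᶠ φ)) (allFin (card G s)))
      ≡⟨ cong not (any-invariant (¬ᶠ φ) (λ L≤ M′ → cong not (invariant φ (suc K) large L≤ M′)) L≤K M x) ⟩
    not (any (λ a → eval G (_[_≔_] {A = G} β x a) (¬ᶠ φ)) (allFin (card G s))) ≡⟨ all≡not-any-not _ (allFin (card G s)) ⟨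
    all (λ a → eval G (_[_≔_] {A = G} β x a) φ) (allFin (card G s))        ∎
    where open ≡-Reasoning
  invariant (# {σ} {k} u φ q) K large {g = g} {q = c} L≤K M = cong₂ _≡ᵇ_
    (count-bijection (∈-tuples G) (unspread-spread g (relocate (radius φ) c)) (spread-unspread g (relocate (radius φ) c))
      (spread-invariant φ (invariant φ (length σ + K) large) L≤K M u) (tuples! G σ))
    (number-matched {k = k} (image M) q)
  invariant (lrec {σ} {k} {l} u v p φE φC w r) K large {L} {g} {q} {α} {β} L≤K M = begin
    X α (values {A = G} α w) (number G (suc l) (values {A = G} α r))
      ≡⟨ X-matched u v p φE φC {N = proj₁ sizes}
           (Invariant-weaken φE (m≤m+n _ _) (invariant φE _ (m+n≤o⇒m≤o _ large)))
           (Invariant-weaken φC (m≤n+m _ _) (invariant φC _ (m+n≤o⇒m≤o _ (m+n≤o⇒n≤o (threshold m φE _) large))))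
           -- At the start no entry is known to persist, and the full allowance `length σ` of
           -- newcomers is open.
           (proj₁ (proj₂ sizes)) L≤K _ (<-wellFounded _) (suc (suc l)) (length σ) [] (values {A = G} α w)
           (<-≤-trans (number-bound G (suc l) (values {A = G} α r)) (proj₂ (proj₂ sizes)))
           [] (λ ()) (λ ()) refl M (far M ∘ values-within (inside M) w) ⟩
    X β (mapTuple (act g q) (values {A = G} α w)) (number G (suc l) (values {A = G} α r))
      ≡⟨ cong₂ (X β) (sym (values-≈ (image M) w)) (number-matched {k = suc l} (image M) r) ⟩
    X β (values {A = G} β w) (number G (suc l) (values {A = G} β r)) ∎
    where
    open ≡-Reasoning
    open LrecInvariance m n using (X-matched)
    X : Assignment G → Tuple G σ → ℕ → Bool
    X = LrecInvariance.X m n u v p φE φC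
    sizes : ∃ λ N → N + (length σ + K) ≤ suc n × suc (suc m * (2 * suc n)) ^ suc l ≤ N ^ suc (suc l)
    sizes = universe-power-bound m n (length σ + K) (suc l)
      (m+n≤o⇒n≤o (threshold m φC _) (m+n≤o⇒n≤o (threshold m φE _) large))

-- Connectivity between the ends, which separates the logics.

reachability : STC-Logic.Formula edgeVocabulary
reachability = STC-Logic.stc (sv 2 ∷ []) (sv 3 ∷ []) (STC-Logic.atom zero (sv 2 ∷ sv 3 ∷ [])) (sv 0 ∷ []) (sv 1 ∷ [])

module Ends (m n : ℕ) where
  open Strands m n
  open Tuples G
  open Indistinguishability m n
  open Invariance m n

  start : Node
  start = vertex zero zero zero

  end : Fin 2 → Node
  end x = vertex (fromℕ< (n<1+n m)) x zero

  -- The remaining structure variables are parked at `start`, so there are just two parameters.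
  ends : Fin 2 → Assignment G
  ends x (sv 0)             = start
  ends x (sv 1)             = end x
  ends x (sv (suc (suc _))) = start
  ends x (nv _)             = zero

  Step : Tuple G (str ∷ []) → Tuple G (str ∷ []) → Set
  Step a b = STC-Logic.Sat G ((ends zero ⟨ sv 2 ∷ [] ↦ a ⟩) ⟨ sv 3 ∷ [] ↦ b ⟩) (STC-Logic.atom zero (sv 2 ∷ sv 3 ∷ []))

  edge-vertex : ∀ p p′ x → suc (toℕ p) ≡ toℕ p′ → T (edge (vertex p x zero) (vertex p′ x zero))
  edge-vertex p p′ x eq rewrite coordinates-vertex p x zero | coordinates-vertex p′ x zero =
    Equivalence.from T-∧ (≡⇒≡ᵇ _ _ eq , ≡⇒≡ᵇ (toℕ x) _ refl)

  path : ∀ i (i≤m : i < suc m) → EqClosure.EqClosure Step (start ∷ []) (vertex (fromℕ< i≤m) zero zero ∷ [])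
  path zero    i≤m = ε
  path (suc i) i<m = path i (<-trans (n<1+n i) i<m) ◅◅ EqClosure.return
    (edge-vertex _ _ zero (trans (cong suc (toℕ-fromℕ< _)) (sym (toℕ-fromℕ< i<m))))

  connected : STC-Logic.Sat G (ends zero) reachability
  connected = path m (n<1+n m)

  -- The strand is constant along edges, hence on classes of the closure, but differs between
  -- `start` and `end (suc zero)`.
  disconnected : ¬ STC-Logic.Sat G (ends (suc zero)) reachability
  disconnected reach with trans (sym (strand-vertex _ _ _)) (trans (EqClosure.gfold isEquivalence (strand ∘ All.head)
    (λ { {_ ∷ []} {_ ∷ []} e → toℕ-injective (≡ᵇ⇒≡ _ _ (proj₂ (Equivalence.to T-∧ e))) }) reach) (strand-vertex _ _ _))
  ... | ()

  -- The cut `suc r` leaves `start` fixed below it and flips `end zero` above it. Distance `r` from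
  -- level `0` asks for `r < suc r`, and distance `r` from level `m` for the hypothesis.
  matched : ∀ r → suc r + r ≤ m → Matched r (start ∷ end zero ∷ []) identity (suc r) (ends zero) (ends (suc zero))
  matched r r≤m = record
    { far    = λ { (here refl) → inj₁ height-start ; (there (here refl)) → inj₂ height-end }
    ; inside = λ { 0 → here refl ; 1 → there (here refl) ; (suc (suc _)) → here refl }
    ; image  = λ { (sv 0) → start-fixed ; (sv 1) → end-flipped ; (sv (suc (suc _))) → start-fixed ; (nv _) → refl }
    }
    where
    height-start : height start + r < suc r
    height-start = ≤-reflexive (cong (λ p → suc (toℕ p + r)) (level-vertex zero zero zero))
    height-end : suc r + r ≤ height (end zero)
    height-end = ≤-trans r≤m (≤-reflexive (sym (trans (cong toℕ (level-vertex _ _ _)) (toℕ-fromℕ< (n<1+n m)))))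
    start-fixed : start ≡ twist (suc r) start
    start-fixed = sym (twist-below (≤-trans (s≤s (m≤m+n _ r)) height-start))
    end-flipped : end (suc zero) ≡ twist (suc r) (end zero)
    end-flipped = sym (trans (twist-above (≤-trans (m≤m+n _ r) height-end)) flip-end)
      where
      flip-end : flip (end zero) ≡ end (suc zero)
      flip-end rewrite coordinates-vertex (fromℕ< (n<1+n m)) zero zero = refl

corollary5p2 : ¬ (STC ≼ LREC)
corollary5p2 STC≼LREC with STC≼LREC edgeVocabulary reachability
... | φ , equivalent = disconnected (Equivalence.from (equivalent G (ends (suc zero)))
  (subst T (invariant φ 2 ≤-refl ≤-refl (matched r ≤-refl)) (Equivalence.to (equivalent G (ends zero)) connected)))
  where
  r m n : ℕ
  -- The order of the choices matters: `r` from `φ`, then `m` just long enough for a cut at distance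
  -- `r` from both ends, and then `n`, whose threshold depends on `m`.
  r = radius φ
  m = suc r + r
  n = threshold m φ 2
  open Strands m n
  open Ends m n
  open Invariance m n
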